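{- For every fixed $k\in\mathbb{N}$, the class of finite undirected graphs of entanglement at most $k$ is closed under taking minors; that is, if $G$ is a minor of $H$ then $\operatorname{ent}(G)\le\operatorname{ent}(H)$.
   Context: For a finite undirected graph $G$ and $k \in \{0,\dots,|V_G|\}$, the entanglement game $\mathcal{E}(G,k)$ is played by Robber against a team of $k$ cops. Positions are triples $(v,C,P)$ with $v\in V_G$ (Robber's current vertex), $C\subseteq V_G$ with $|C|\le k$ (vertices occupied by cops), and $P\in\{\text{Cops},\text{Robber}\}$ (player to move). Initially Robber chooses any $v_0\in V_G$, giving position $(v_0,\emptyset,\text{Cops})$. From $(v,C,\text{Cops})$ Cops move to $(v,C',\text{Robber})$ where $C'$ is either $C$ (skip), $C\cup\{v\}$ (place a new cop on Robber's current vertex), or $(C\setminus\{x\})\cup\{v\}$ for some $x\in C$ (move a placed cop to Robber's current vertex). From $(v,C,\text{Robber})$ Robber must move to $(v',C,\text{Cops})$ where $v'$ is adjacent to $v$ and $v'\notin C$; if no such $v'$ exists Robber is caught. Every finite play is a win for Cops, every infinite play a win for Robber. The entanglement $\operatorname{ent}(G)$ is the minimum $k$ such that Cops have a winning strategy in $\mathcal{E}(G,k)$. A graph $G$ is a minor of $H$ if $G$ can be obtained from $H$ by successive applications of: deleting an edge; contracting an edge (the two end-vertices of the edge $e$ are replaced by a single new vertex $z$ adjacent to all neighbors of the two replaced vertices); deleting an isolated vertex. -}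

module Defs where

open import Level using (Level; 0ℓ) renaming (suc to lsuc)
open import Data.Nat using (ℕ; zero; suc; _≤_)
open import Data.Fin using (Fin; toℕ; punchIn; punchOut; _≟_)
open import Data.Fin.Subset using (Subset; ⊥; ⁅_⁆; _∪_; _-_; _∈_; _∉_; ∣_∣)
open import Data.List using (List; tabulate)
open import Data.Product using (Σ; ∃; ∃-syntax; _×_; _,_; proj₁)
open import Data.Sum using (_⊎_)
open import Relation.Nullary using (¬_; yes; no)
open import Relation.Binary.PropositionalEquality using (_≡_; _≢_; refl; sym)
open import Function.Bundles using (_↔_; Inverse; _⇔_)

record Graph (n : ℕ) : Set₁ where
  field
    E     : Fin n → Fin n → Set
    E-sym : ∀ {i j} → E i j → E j i
    irrefl : ∀ {i} → ¬ E i i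
open Graph public

-- Legal Cops move from (v , C , Cops) to (v , C' , Robber):
-- skip, place a new cop on v, or move a placed cop x ∈ C to v;
-- the resulting position must satisfy ∣ C' ∣ ≤ k.
Legal : ∀ {n} → ℕ → Fin n → Subset n → Subset n → Set
Legal k v C C' =
  ( C' ≡ C
  ⊎ C' ≡ C ∪ ⁅ v ⁆
  ⊎ (∃[ x ] (x ∈ C × C' ≡ (C - x) ∪ ⁅ v ⁆)) )
  × ∣ C' ∣ ≤ k

-- A (general, history dependent) Cops strategy: given the history of
-- previous Cops-to-move positions and the current position (v , C , Cops)
-- with ∣ C ∣ ≤ k, it yields a legal successor cop set.
CopStrategy : ℕ → ℕ → Set
CopStrategy n k =
  List (Fin n × Subset n) → (v : Fin n) → (C : Subset n) → ∣ C ∣ ≤ k →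
  Σ (Subset n) (Legal k v C)

-- An infinite play consistent with a Cops strategy σ in 𝓔(G,k),
-- recorded by its Cops-to-move positions (pos i , cops i , Cops).
-- Robber picks pos 0 freely, cops 0 = ∅.
record InfinitePlay {n k : ℕ} (G : Graph n) (σ : CopStrategy n k) : Set where
  field
    pos   : ℕ → Fin n
    cops  : ℕ → Subset n
    bound : ∀ i → ∣ cops i ∣ ≤ k
    start : cops 0 ≡ ⊥
    copsMove : ∀ i →
      cops (suc i) ≡ proj₁ (σ (tabulate {n = i} (λ j → pos (toℕ j) , cops (toℕ j)))
                              (pos i) (cops i) (bound i))
    robberEdge : ∀ i → E G (pos i) (pos (suc i))
    robberFree : ∀ i → pos (suc i) ∉ cops (suc i)

-- Cops win 𝓔(G,k): there is a strategy such that every consistent play is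
-- finite, i.e. no infinite play is consistent with it.
CopsWin : ∀ {n} → Graph n → ℕ → Set
CopsWin {n} G k = Σ (CopStrategy n k) λ σ → ¬ InfinitePlay G σ

-- ent(G) ≤ k, where ent(G) = min { j ≤ |V_G| : Cops win 𝓔(G,j) }.
EntAtMost : ∀ {n} → Graph n → ℕ → Set
EntAtMost {n} G k = ∃[ j ] (j ≤ k × j ≤ n × CopsWin G j)

record Iso {n : ℕ} (G H : Graph n) : Set where
  field
    bij  : Fin n ↔ Fin n
    pres : ∀ i j → E G i j ⇔ E H (Inverse.to bij i) (Inverse.to bij j)

deleteEdge : ∀ {n} (H : Graph n) (a b : Fin n) → Graph n
deleteEdge H a b = record
  { E = λ i j → E H i j × ¬ ((i ≡ a × j ≡ b) ⊎ (i ≡ b × j ≡ a))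
  ; E-sym = λ { (e , ne) → E-sym H e , λ { (_⊎_.inj₁ (p , q)) → ne (_⊎_.inj₂ (q , p))
                                           ; (_⊎_.inj₂ (p , q)) → ne (_⊎_.inj₁ (q , p)) } }
  ; irrefl = λ { (e , _) → irrefl H e }
  }

deleteVertex : ∀ {n} (H : Graph (suc n)) (x : Fin (suc n)) → Graph n
deleteVertex H x = record
  { E = λ i j → E H (punchIn x i) (punchIn x j)
  ; E-sym = E-sym H
  ; irrefl = irrefl H
  }

-- quotient map for contracting the edge {a,b}: b is merged into a,
-- the merged vertex z is (the image of) a.
mergeMap : ∀ {n} {a b : Fin (suc n)} → a ≢ b → Fin (suc n) → Fin n
mergeMap {a = a} {b} a≢b u with u ≟ b
... | yes _   = punchOut {i = b} {j = a} (λ p → a≢b (sym p))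
... | no u≢b  = punchOut {i = b} {j = u} (λ p → u≢b (sym p))

contract : ∀ {n} (H : Graph (suc n)) (a b : Fin (suc n)) → a ≢ b → Graph n
contract H a b a≢b = record
  { E = λ i j → i ≢ j × ∃[ u ] ∃[ w ]
          (mergeMap a≢b u ≡ i × mergeMap a≢b w ≡ j × E H u w)
  ; E-sym = λ { (i≢j , u , w , p , q , e) →
              (λ eq → i≢j (sym eq)) , w , u , q , p , E-sym H e }
  ; irrefl = λ { (i≢i , _) → i≢i refl }
  }

data Minor : ∀ {m n} → Graph m → Graph n → Set₁ where
  iso        : ∀ {n} {G H : Graph n} → Iso G H → Minor G H
  byDelEdge  : ∀ {m n} {G : Graph m} {H : Graph n} (a b : Fin n) →
               E H a b → Minor G (deleteEdge H a b) → Minor G H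
  byContract : ∀ {m n} {G : Graph m} {H : Graph (suc n)} (a b : Fin (suc n))
               (a≢b : a ≢ b) → E H a b → Minor G (contract H a b a≢b) → Minor G H
  byDelVertex : ∀ {m n} {G : Graph m} {H : Graph (suc n)} (x : Fin (suc n)) →
               (∀ y → ¬ E H x y) → Minor G (deleteVertex H x) → Minor G H

{-# OPTIONS --safe #-}
-- Call a position catchable if the cops can enforce a win within some number
-- of rounds in the variant where they may also drop cops for free.
--
-- If the cops win on H, then every initial position of H is not not catchable,
-- since otherwise a robber who avoids catchable positions plays forever.
--
-- Catchability passes to minors.  For the contraction of an edge ab to z, a
-- robber on z is simulated by a robber who alternates between a and b until
-- the cops occupy one of them; only then do the cops occupy z.  From there the
-- simulated robber reaches the exit he needs via the other end of the edge.
--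
-- Edges are not decidable, so a catching strategy cannot be extracted from the
-- double negation.  Instead one strategy, which does not depend on the graph,
-- plays all finite plans one after another, each as if no cop had been placed
-- before; the robber cannot survive a plan that catches him on his graph.
module Submission where

open import Defs
open import Data.Bool using (true; false)
open import Data.Empty using () renaming (⊥ to Absurd)
open import Data.Fin using (Fin; zero; suc; toℕ; punchIn; punchOut; _≟_)
open import Data.Fin.Properties using (any?; ¬∀⟶∃¬; punchInᵢ≢i; punchOut-cong; punchOut-injective; punchOut-punchIn)
open import Data.Fin.Subset using (Subset; inside; outside; ⊥; ⁅_⁆; _∪_; _-_; _∈_; _∉_; _⊆_; ∣_∣)
open import Data.Fin.Subset.Properties using (_∈?_; ∉⊥; ⊥⊆; ∣⊥∣≡0; ∣p∣≤n; x∈⁅x⁆; x∈⁅y⁆⇒x≡y; p⊆q⇒∣p∣≤∣q∣; p⊆p∪q; q⊆p∪q; x∈p∪q⁻; x∈p∧x≢y⇒x∈p-y; x∈p⇒p-x⊂p; x∈p⇒∣p-x∣<∣p∣; ∪-identityʳ)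
open import Data.List using (List; []; _∷_; _∷ʳ_; tabulate; foldl; cartesianProduct; cartesianProductWith)
open import Data.List.Membership.Propositional using () renaming (_∈_ to _∈ₗ_)
open import Data.List.Membership.Propositional.Properties using (∈-cartesianProduct⁺; ∈-cartesianProductWith⁺)
open import Data.List.Properties using (foldl-∷ʳ)
open import Data.List.Relation.Unary.Any using (here; there)
open import Data.Nat using (ℕ; zero; suc; _≤_; _⊓_; _⊔_; z≤n; s≤s; _≤?_)
open import Data.Nat.Properties using (≤-refl; ≤-trans; ≤-reflexive; n≤1+n; m≤m⊔n; m≤n⊔m; ⊓-glb; m⊓n≤m; m⊓n≤n)
open import Data.Product using (∃-syntax; Σ-syntax; _×_; _,_; proj₁; proj₂)
open import Data.Sum using (_⊎_; inj₁; inj₂; [_,_]′)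
open import Data.Unit using (⊤; tt)
open import Data.Vec using (Vec; []; _∷_; lookup; replicate) renaming (tabulate to tabulateᵥ; here to hereᵥ; there to thereᵥ)
open import Data.Vec.Properties using (lookup∘tabulate)
open import Function using (_∘_; id)
open import Function.Bundles using (Inverse; Equivalence)
open import Relation.Binary.PropositionalEquality using (_≡_; _≢_; refl; sym; trans; cong; subst)
open import Relation.Nullary using (¬_; Dec; yes; no; contradiction; ¬?; _×-dec_; _→-dec_)
open import Relation.Nullary.Decidable using (¬¬-excluded-middle; decidable-stable)

private
  variable
    k m n : ℕ

-- Subsets

∣p∪⁅x⁆∣≤1+∣p∣ : ∀ (p : Subset n) x → ∣ p ∪ ⁅ x ⁆ ∣ ≤ suc ∣ p ∣
∣p∪⁅x⁆∣≤1+∣p∣ (inside ∷ p) zero rewrite ∪-identityʳ p = n≤1+n _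
∣p∪⁅x⁆∣≤1+∣p∣ (outside ∷ p) zero rewrite ∪-identityʳ p = ≤-refl
∣p∪⁅x⁆∣≤1+∣p∣ (inside ∷ p) (suc x) = s≤s (∣p∪⁅x⁆∣≤1+∣p∣ p x)
∣p∪⁅x⁆∣≤1+∣p∣ (outside ∷ p) (suc x) = ∣p∪⁅x⁆∣≤1+∣p∣ p x

∈-∪⁅⁆⁻ : ∀ (p : Subset n) {v x} → x ∈ p ∪ ⁅ v ⁆ → x ∈ p ⊎ x ≡ v
∈-∪⁅⁆⁻ p {v} x∈ with x∈p∪q⁻ p ⁅ v ⁆ x∈
... | inj₁ x∈p = inj₁ x∈p
... | inj₂ x∈v = inj₂ (x∈⁅y⁆⇒x≡y v x∈v)

⊆∪⁅⁆ : ∀ (p : Subset n) {v x} → x ∈ p → x ∈ p ∪ ⁅ v ⁆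
⊆∪⁅⁆ p {v} = p⊆p∪q ⁅ v ⁆

v∈∪⁅v⁆ : ∀ (p : Subset n) {v x} → x ≡ v → x ∈ p ∪ ⁅ v ⁆
v∈∪⁅v⁆ p {v} refl = q⊆p∪q p ⁅ v ⁆ (x∈⁅x⁆ v)

image : (Fin m → Fin n) → Subset m → Subset n
image f []            = ⊥
image f (inside ∷ p)  = image (f ∘ suc) p ∪ ⁅ f zero ⁆
image f (outside ∷ p) = image (f ∘ suc) p

∈-image⁺ : ∀ (f : Fin m → Fin n) {x} p → x ∈ p → f x ∈ image f p
∈-image⁺ f {zero}  (inside ∷ p)  x∈p = v∈∪⁅v⁆ (image (f ∘ suc) p) refl
∈-image⁺ f {suc x} (inside ∷ p)  (thereᵥ x∈p) = ⊆∪⁅⁆ (image (f ∘ suc) p) (∈-image⁺ (f ∘ suc) p x∈p)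
∈-image⁺ f {suc x} (outside ∷ p) (thereᵥ x∈p) = ∈-image⁺ (f ∘ suc) p x∈p

∈-image⁻ : ∀ (f : Fin m → Fin n) p {y} → y ∈ image f p → ∃[ x ] (x ∈ p × f x ≡ y)
∈-image⁻ f []            y∈ = contradiction y∈ ∉⊥
∈-image⁻ f (inside ∷ p)  y∈ with ∈-∪⁅⁆⁻ (image (f ∘ suc) p) y∈
... | inj₂ y≡ = zero , hereᵥ , sym y≡
... | inj₁ y∈′ with ∈-image⁻ (f ∘ suc) p y∈′
...   | x , x∈p , eq = suc x , thereᵥ x∈p , eq
∈-image⁻ f (outside ∷ p) y∈ with ∈-image⁻ (f ∘ suc) p y∈
... | x , x∈p , eq = suc x , thereᵥ x∈p , eq

∣image∣≤ : ∀ (f : Fin m → Fin n) p → ∣ image f p ∣ ≤ ∣ p ∣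
∣image∣≤ {n = n} f [] = ≤-reflexive (∣⊥∣≡0 n)
∣image∣≤ f (inside ∷ p)  = ≤-trans (∣p∪⁅x⁆∣≤1+∣p∣ (image (f ∘ suc) p) (f zero)) (s≤s (∣image∣≤ (f ∘ suc) p))
∣image∣≤ f (outside ∷ p) = ∣image∣≤ (f ∘ suc) p

-- Catchable positions

-- Allowing drops makes the notion monotone in `C` and compatible with vertex maps: when a map
-- identifies vertices, the image of a legal move can amount to a drop.
CatchIn : Graph n → ℕ → ℕ → Fin n → Subset n → Set
CatchIn G k zero    v C = Absurd
CatchIn G k (suc d) v C =
  ∃[ D ] (D ⊆ C ∪ ⁅ v ⁆ × ∣ D ∣ ≤ k × (∀ w → E G v w → w ∉ D → CatchIn G k d w D))

Catchable : Graph n → ℕ → Fin n → Subset n → Set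
Catchable G k v C = ∃[ d ] CatchIn G k d v C

catchIn-weaken : ∀ (G : Graph n) {d d′ v C C′} → d ≤ d′ → C ⊆ C′ →
                 CatchIn G k d v C → CatchIn G k d′ v C′
catchIn-weaken G {C = C} {C′} (s≤s d≤d′) C⊆C′ (D , D⊆ , ∣D∣≤k , next) =
  D , ([ ⊆∪⁅⁆ C′ ∘ C⊆C′ , v∈∪⁅v⁆ C′ ]′ ∘ ∈-∪⁅⁆⁻ C ∘ D⊆) , ∣D∣≤k ,
  λ w e w∉D → catchIn-weaken G d≤d′ id (next w e w∉D)

-- Needed because `EntAtMost` also bounds the cop number by the number of vertices, a bound that
-- every vertex set obeys.
catchIn-⊓ : ∀ (G : Graph n) d {v C} → CatchIn G k d v C → CatchIn G (k ⊓ n) d v C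
catchIn-⊓ G (suc d) (D , D⊆ , ∣D∣≤k , next) =
  D , D⊆ , ⊓-glb ∣D∣≤k (∣p∣≤n D) , λ w e w∉D → catchIn-⊓ G d (next w e w∉D)

upward-∃∀ : ∀ n {Q : ℕ → Fin n → Set} → (∀ {d d′ i} → d ≤ d′ → Q d i → Q d′ i) →
            (∀ i → ∃[ d ] Q d i) → ∃[ d ] (∀ i → Q d i)
upward-∃∀ zero    mono f = 0 , λ ()
upward-∃∀ (suc n) mono f with f zero | upward-∃∀ n mono (f ∘ suc)
... | d₀ , q₀ | d , q = d₀ ⊔ d , λ { zero → mono (m≤m⊔n d₀ d) q₀ ; (suc i) → mono (m≤n⊔m d₀ d) (q i) }

-- Depths can be raised, so the maximum over the finitely many vertices serves all of them; vertices
-- outside `P` contribute 0.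
catchable-uniform : ∀ (G : Graph n) {P : Fin n → Set} {C} → (∀ v → Dec (P v)) →
                    (∀ v → P v → Catchable G k v C) →
                    ∃[ d ] (∀ v → P v → CatchIn G k d v C)
catchable-uniform {n} {k} G {P} {C} P? f =
  upward-∃∀ n (λ d≤d′ q p → catchIn-weaken G d≤d′ id (q p)) depth
  where
  depth : ∀ v → ∃[ d ] (P v → CatchIn G k d v C)
  depth v with P? v
  ... | no ¬p = 0 , λ p → contradiction p ¬p
  ... | yes p with f v p
  ...   | d , c = d , λ _ → c

-- Minors

-- The robber of `G` is shadowed in `H` along `f`, and the cops are carried back along `g`. A `w`
-- outside the image of `D` has `f w` outside `D`, since `g` retracts `f`.
catchIn-embed : ∀ {G : Graph m} {H : Graph n} (f : Fin m → Fin n) (g : Fin n → Fin m) →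
                (∀ v → g (f v) ≡ v) → (∀ {v w} → E G v w → E H (f v) (f w)) →
                ∀ d {v C} → CatchIn H k d (f v) C → CatchIn G k d v (image g C)
catchIn-embed {G = G} f g gf pres (suc d) {v} {C} (D , D⊆ , ∣D∣≤k , next) =
  image g D , sub , ≤-trans (∣image∣≤ g D) ∣D∣≤k ,
  λ w e w∉ → catchIn-embed {G = G} f g gf pres d
    (next (f w) (pres e) λ fw∈D → w∉ (subst (_∈ image g D) (gf w) (∈-image⁺ g D fw∈D)))
  where
  sub : image g D ⊆ image g C ∪ ⁅ v ⁆
  sub y∈ with ∈-image⁻ g D y∈
  ... | x , x∈D , refl with ∈-∪⁅⁆⁻ C (D⊆ x∈D)
  ...   | inj₁ x∈C  = ⊆∪⁅⁆ (image g C) (∈-image⁺ g C x∈C)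
  ...   | inj₂ refl = v∈∪⁅v⁆ (image g C) (gf v)

-- Contracting an edge

module _ {G : Graph m} {H : Graph n} (g : Fin n → Fin m) where

  SingletonFibre EdgeFibre : Fin n → Set
  SingletonFibre u = ∀ u′ → g u′ ≡ g u → u′ ≡ u
  EdgeFibre u = ∃[ c ] (E H u c × g c ≡ g u × (∀ u′ → g u′ ≡ g u → u′ ≡ u ⊎ u′ ≡ c))

  module _ (lift : ∀ {i j} → E G i j → ∃[ u ] ∃[ w ] (g u ≡ i × g w ≡ j × E H u w))
           (fibre : ∀ u → SingletonFibre u ⊎ EdgeFibre u) where

    image-move : ∀ {u} {C D : Subset n} → D ⊆ C ∪ ⁅ u ⁆ → image g D ⊆ image g C ∪ ⁅ g u ⁆
    image-move {u} {C} {D} D⊆ y∈ with ∈-image⁻ g D y∈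
    ... | x , x∈D , refl with ∈-∪⁅⁆⁻ C (D⊆ x∈D)
    ...   | inj₁ x∈C  = ⊆∪⁅⁆ (image g C) (∈-image⁺ g C x∈C)
    ...   | inj₂ refl = v∈∪⁅v⁆ (image g C) refl

    -- A cop entering a fibre that already holds one does not enlarge the image.
    image-move-old : ∀ {u} {C D : Subset n} → D ⊆ C ∪ ⁅ u ⁆ → g u ∈ image g C → image g D ⊆ image g C
    image-move-old {u} {C} {D} D⊆ gu∈ y∈ with ∈-∪⁅⁆⁻ (image g C) (image-move {C = C} {D} D⊆ y∈)
    ... | inj₁ y∈C  = y∈C
    ... | inj₂ refl = gu∈

    -- The invariant is that no cop stands in the fibre of `u`, so the simulated robber is free to
    -- step to the other end of the contracted edge.
    catchIn-contract : ∀ d {u C} → CatchIn H k d u C → g u ∉ image g C →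
                       CatchIn G k d (g u) (image g C)

    -- The robber of `G` is already on `g w`, while the simulated one is still on `c`, with a cop in
    -- its fibre. The answer `D₂` given there covers no new fibre, so the cops of `G` can do without
    -- that round.
    catchIn-detour : ∀ d {c w D} → CatchIn H k d c D → g c ∈ image g D → E H c w →
                     g w ∉ image g D → CatchIn G k d (g w) (image g D)
    catchIn-detour (suc d) {c} {w} {D} (D₂ , D₂⊆ , ∣D₂∣≤k , next) gc∈D e gw∉D =
      catchIn-weaken G (n≤1+n d) shrink
        (catchIn-contract d (next w e (gw∉D ∘ shrink ∘ ∈-image⁺ g D₂)) (gw∉D ∘ shrink))
      where
      shrink : image g D₂ ⊆ image g D
      shrink = image-move-old {C = D} {D₂} D₂⊆ gc∈D

    catchIn-contract {k = k} (suc d) {u} {C} (D , D⊆ , ∣D∣≤k , next) gu∉ with fibre u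
    ... | inj₁ single =
      image g D , image-move {C = C} {D} D⊆ , ≤-trans (∣image∣≤ g D) ∣D∣≤k , reply
      where
      reply : ∀ v → E G (g u) v → v ∉ image g D → CatchIn G k d v (image g D)
      reply v e v∉ with lift e
      ... | u₁ , w , gu₁≡ , refl , e′ with single u₁ gu₁≡
      ...   | refl = catchIn-contract d (next w e′ (v∉ ∘ ∈-image⁺ g D)) v∉
    ... | inj₂ (c , uc , gc≡gu , pair) with u ∈? D
    -- The cops did not occupy u, so the simulated robber steps to c while the
    -- robber of G stays put.
    ...   | no u∉D =
      catchIn-weaken G (n≤1+n d) imD⊆imC
        (subst (λ v → CatchIn G k d v (image g D)) gc≡gu
          (catchIn-contract d (next c uc (gu∉ ∘ subst (_∈ image g C) gc≡gu ∘ ∈-image⁺ g C ∘ D⊆C))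
            (gu∉ ∘ subst (_∈ image g C) gc≡gu ∘ imD⊆imC)))
      where
      D⊆C : D ⊆ C
      D⊆C x∈D with ∈-∪⁅⁆⁻ C (D⊆ x∈D)
      ... | inj₁ x∈C  = x∈C
      ... | inj₂ refl = contradiction x∈D u∉D
      imD⊆imC : image g D ⊆ image g C
      imD⊆imC y∈ with ∈-image⁻ g D y∈
      ... | x , x∈D , refl = ∈-image⁺ g C (D⊆C x∈D)
    ...   | yes u∈D =
      image g D , image-move {C = C} {D} D⊆ , ≤-trans (∣image∣≤ g D) ∣D∣≤k , reply
      where
      -- The answer adds at most `u`, so `c` stays open for the detour.
      c∉D : c ∉ D
      c∉D c∈D with ∈-∪⁅⁆⁻ C (D⊆ c∈D)
      ... | inj₁ c∈C  = gu∉ (subst (_∈ image g C) gc≡gu (∈-image⁺ g C c∈C))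
      ... | inj₂ refl = irrefl H uc
      reply : ∀ v → E G (g u) v → v ∉ image g D → CatchIn G k d v (image g D)
      reply v e v∉ with lift e
      ... | u₁ , w , gu₁≡ , refl , e′ with pair u₁ gu₁≡
      ...   | inj₁ refl = catchIn-contract d (next w e′ (v∉ ∘ ∈-image⁺ g D)) v∉
      -- The exit edge starts at `c`, so the simulated robber first crosses to `c`.
      ...   | inj₂ refl =
        catchIn-detour d (next c uc c∉D)
          (subst (_∈ image g D) (sym gc≡gu) (∈-image⁺ g D u∈D)) e′ v∉

module _ {a b : Fin (suc n)} (a≢b : a ≢ b) where

  mergeMap-≡ : mergeMap a≢b a ≡ mergeMap a≢b b
  mergeMap-≡ with a ≟ b | b ≟ b
  ... | yes a≡b | _     = contradiction a≡b a≢b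
  ... | no _    | no b≢ = contradiction refl b≢
  ... | no _    | yes _ = punchOut-cong b refl

  mergeMap-punchIn : ∀ v → mergeMap a≢b (punchIn b v) ≡ v
  mergeMap-punchIn v with punchIn b v ≟ b
  ... | yes eq = contradiction eq (punchInᵢ≢i b v)
  ... | no _   = trans (punchOut-cong b refl) (punchOut-punchIn b)

  mergeMap-fibre : ∀ u u′ → mergeMap a≢b u′ ≡ mergeMap a≢b u →
                   u′ ≡ u ⊎ ((u ≡ a ⊎ u ≡ b) × (u′ ≡ a ⊎ u′ ≡ b))
  mergeMap-fibre u u′ eq with u ≟ b | u′ ≟ b
  ... | yes p | yes q = inj₁ (trans q (sym p))
  ... | yes p | no  q = inj₂ (inj₂ p , inj₁ (punchOut-injective (q ∘ sym) (a≢b ∘ sym) eq))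
  ... | no  p | yes q = inj₂ (inj₁ (sym (punchOut-injective (a≢b ∘ sym) (p ∘ sym) eq)) , inj₂ q)
  ... | no  p | no  q = inj₁ (punchOut-injective (q ∘ sym) (p ∘ sym) eq)

  mergeMap-fibres : ∀ {H : Graph (suc n)} → E H a b → ∀ u →
                    SingletonFibre {G = contract H a b a≢b} {H} (mergeMap a≢b) u ⊎
                    EdgeFibre {G = contract H a b a≢b} {H} (mergeMap a≢b) u
  mergeMap-fibres {H} ab u = cases (u ≟ a) (u ≟ b)
    where
    cases : Dec (u ≡ a) → Dec (u ≡ b) → _
    cases (yes refl) _ = inj₂ (b , ab , sym mergeMap-≡ , λ u′ eq → [ inj₁ , proj₂ ]′ (mergeMap-fibre a u′ eq))
    cases (no _) (yes refl) = inj₂ (a , E-sym H ab , mergeMap-≡ ,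
      λ u′ eq → [ inj₁ , [ inj₂ , inj₁ ]′ ∘ proj₂ ]′ (mergeMap-fibre b u′ eq))
    cases (no u≢a) (no u≢b) = inj₁ λ u′ eq →
      [ id , (λ (u∈ , _) → contradiction u∈ [ u≢a , u≢b ]′) ]′ (mergeMap-fibre u u′ eq)

catchable-⊥ : ∀ {f : Fin n → Fin m} {G : Graph m} {v} d → CatchIn G k d v (image f ⊥) → Catchable G k v ⊥
catchable-⊥ {f = f} {G} d c =
  d , catchIn-weaken G ≤-refl (λ y∈ → contradiction (proj₁ (proj₂ (∈-image⁻ f ⊥ y∈))) ∉⊥) c

catchable-embed : ∀ (G : Graph m) (H : Graph n) (f : Fin m → Fin n) (g : Fin n → Fin m) →
                  (∀ v → g (f v) ≡ v) → (∀ {v w} → E G v w → E H (f v) (f w)) →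
                  ∀ v → Catchable H k (f v) ⊥ → Catchable G k v ⊥
catchable-embed G H f g gf pres v (d , c) = catchable-⊥ {f = g} d (catchIn-embed {G = G} {H} f g gf pres d c)

catchable-minor : ∀ {G : Graph m} {H : Graph n} → Minor G H →
                  (∀ v → Catchable H k v ⊥) → ∀ v → Catchable G k v ⊥
catchable-minor (iso {G = G} {H} i) all v =
  catchable-embed G H (Inverse.to bij) (Inverse.from bij) (Inverse.strictlyInverseʳ bij)
    (λ {v} {w} → Equivalence.to (pres v w)) v (all _)
  where open Iso i
catchable-minor (byDelEdge {H = H} a b _ M) all =
  catchable-minor M λ v → catchable-embed (deleteEdge H a b) H id id (λ _ → refl) proj₁ v (all v)
catchable-minor (byContract {H = H} a b a≢b ab M) all = catchable-minor M reply
  where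
  reply : ∀ v → Catchable (contract H a b a≢b) _ v ⊥
  reply v with all (punchIn b v)
  ... | d , c = subst (λ v → Catchable (contract H a b a≢b) _ v ⊥) (mergeMap-punchIn a≢b v)
    (catchable-⊥ {f = mergeMap a≢b} d
      (catchIn-contract {G = contract H a b a≢b} {H} (mergeMap a≢b) proj₂ (mergeMap-fibres a≢b {H} ab) d c
        λ y∈ → ∉⊥ (proj₁ (proj₂ (∈-image⁻ (mergeMap a≢b) ⊥ y∈)))))
catchable-minor (byDelVertex {n = n} {H = H} x _ M) all = catchable-minor M λ v →
  catchable-embed (deleteVertex H x) H (punchIn x) (collapse v) (collapse-punchIn v) id v (all _)
  where
  -- The retraction must send the deleted `x` somewhere; `v` is merely a vertex at hand.
  collapse : Fin n → Fin (suc n) → Fin n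
  collapse v u with x ≟ u
  ... | yes _  = v
  ... | no x≢u = punchOut x≢u
  collapse-punchIn : ∀ v w → collapse v (punchIn x w) ≡ w
  collapse-punchIn v w with x ≟ punchIn x w
  ... | yes eq = contradiction (sym eq) (punchInᵢ≢i x w)
  ... | no _   = trans (punchOut-cong x refl) (punchOut-punchIn x)

-- From winning strategies to catchable positions

-- Double negation commutes with finite quantification, so a proof of a negation may assume excluded
-- middle for all vertices at once.
¬¬-∀-Fin : ∀ n {P : Fin n → Set} → (∀ i → ¬ ¬ P i) → ¬ ¬ (∀ i → P i)
¬¬-∀-Fin zero    f ¬all = ¬all λ ()
¬¬-∀-Fin (suc n) f ¬all = f zero λ p → ¬¬-∀-Fin n (f ∘ suc) λ q → ¬all λ { zero → p ; (suc i) → q i }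

¬¬-∀-Subset : ∀ n {P : Subset n → Set} → (∀ p → ¬ ¬ P p) → ¬ ¬ (∀ p → P p)
¬¬-∀-Subset zero    f ¬all = f [] λ p → ¬all λ { [] → p }
¬¬-∀-Subset (suc n) f ¬all =
  ¬¬-∀-Subset n (f ∘ (inside ∷_)) λ p → ¬¬-∀-Subset n (f ∘ (outside ∷_)) λ q →
  ¬all λ { (inside ∷ s) → p s ; (outside ∷ s) → q s }

¬¬-decidable-E : ∀ (G : Graph n) → ¬ ¬ (∀ v w → Dec (E G v w))
¬¬-decidable-E {n} G = ¬¬-∀-Fin n λ v → ¬¬-∀-Fin n λ w → ¬¬-excluded-middle

tabulate-toℕ-∷ʳ : ∀ {A : Set} (f : ℕ → A) i →
                  tabulate {n = suc i} (f ∘ toℕ) ≡ tabulate {n = i} (f ∘ toℕ) ∷ʳ f i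
tabulate-toℕ-∷ʳ f zero    = refl
tabulate-toℕ-∷ʳ f (suc i) = cong (f 0 ∷_) (tabulate-toℕ-∷ʳ (f ∘ suc) i)

legal-⊆ : ∀ {v} {C C′ : Subset n} → Legal k v C C′ → C′ ⊆ C ∪ ⁅ v ⁆
legal-⊆ {C = C} (inj₁ refl , _) x∈ = ⊆∪⁅⁆ C x∈
legal-⊆ (inj₂ (inj₁ refl) , _) x∈ = x∈
legal-⊆ {C = C} (inj₂ (inj₂ (x , x∈C , refl)) , _) y∈ with ∈-∪⁅⁆⁻ (C - x) y∈
... | inj₁ y∈C- = ⊆∪⁅⁆ C (proj₁ (x∈p⇒p-x⊂p x∈C) y∈C-)
... | inj₂ y≡v  = v∈∪⁅v⁆ C y≡v

module Evasion (H : Graph n) (σ : CopStrategy n k)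
               (E? : ∀ v w → Dec (E H v w)) (catchable? : ∀ v C → Dec (Catchable H k v C)) where

  record Position : Set where
    constructor position
    field
      history : List (Fin n × Subset n)
      robber  : Fin n
      guards  : Subset n
      few     : ∣ guards ∣ ≤ k
      safe    : ¬ Catchable H k robber guards
  open Position

  move : Position → Subset n
  move s = proj₁ (σ (history s) (robber s) (guards s) (few s))

  move-legal : ∀ s → Legal k (robber s) (guards s) (move s)
  move-legal s = proj₂ (σ (history s) (robber s) (guards s) (few s))

  -- If every free neighbour were catchable, a common depth `d` would exist by `catchable-uniform`,
  -- and `move s` would witness that `s` itself is catchable in `suc d` rounds.
  escape : ∀ s → ∃[ w ] (E H (robber s) w × w ∉ move s × ¬ Catchable H k w (move s))
  escape s with ¬∀⟶∃¬ n (λ w → E H (robber s) w × w ∉ move s → Catchable H k w (move s))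
                  (λ w → (E? (robber s) w ×-dec ¬? (w ∈? move s)) →-dec catchable? w (move s)) caught
    where
    caught : ¬ (∀ w → E H (robber s) w × w ∉ move s → Catchable H k w (move s))
    caught f with catchable-uniform H (λ w → E? (robber s) w ×-dec ¬? (w ∈? move s)) f
    ... | d , c = safe s (suc d , move s , legal-⊆ (move-legal s) , proj₂ (move-legal s) , λ w e w∉ → c w (e , w∉))
  ... | w , ¬caught = w ,
    proj₁ free , proj₂ free , λ c → ¬caught λ _ → c
    where
    free : E H (robber s) w × w ∉ move s
    free = decidable-stable (E? (robber s) w ×-dec ¬? (w ∈? move s)) λ ¬p → ¬caught λ p → contradiction p ¬p

  next : Position → Position
  next s = position (history s ∷ʳ (robber s , guards s)) (proj₁ (escape s)) (move s)
                    (proj₂ (move-legal s)) (proj₂ (proj₂ (proj₂ (escape s))))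

  module _ (v : Fin n) (¬c : ¬ Catchable H k v ⊥) where

    at : ℕ → Position
    at zero    = position [] v ⊥ (≤-trans (≤-reflexive (∣⊥∣≡0 n)) z≤n) ¬c
    at (suc i) = next (at i)

    history-at : ∀ i → history (at i) ≡ tabulate {n = i} (λ j → robber (at (toℕ j)) , guards (at (toℕ j)))
    history-at zero    = refl
    history-at (suc i) = trans (cong (_∷ʳ (robber (at i) , guards (at i))) (history-at i))
                               (sym (tabulate-toℕ-∷ʳ (λ j → robber (at j) , guards (at j)) i))

    evasion : InfinitePlay H σ
    evasion = record
      { pos        = robber ∘ at
      ; cops       = guards ∘ at
      ; bound      = few ∘ at
      ; start      = refl
      ; copsMove   = λ i → cong (λ h → proj₁ (σ h (robber (at i)) (guards (at i)) (few (at i)))) (history-at i)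
      ; robberEdge = λ i → proj₁ (proj₂ (escape (at i)))
      ; robberFree = λ i → proj₁ (proj₂ (proj₂ (escape (at i))))
      }

copsWin⇒catchable : ∀ (H : Graph n) → CopsWin H k → ¬ ¬ (∀ v → Catchable H k v ⊥)
copsWin⇒catchable {n} {k} H (σ , wins) ¬all =
  ¬¬-decidable-E H λ E? →
  ¬¬-∀-Fin n (λ v → ¬¬-∀-Subset n λ C → ¬¬-excluded-middle) λ catchable? →
  ¬all λ v → decidable-stable (catchable? v ⊥) λ ¬c → wins (Evasion.evasion H σ E? catchable? v ¬c)

-- Finite plans

-- A decision tree on the robber's vertex that mentions no graph, so for given `n` and `d` there are
-- finitely many. Vectors instead of functions let the enumeration `plans` be complete up to
-- propositional equality.
Plan : ℕ → ℕ → Set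
Plan n zero    = ⊤
Plan n (suc d) = Vec (Subset n × Plan n d) n

idle : ∀ d → Plan n d
idle zero    = tt
idle (suc d) = replicate _ (⊥ , idle d)

vectors : ∀ {A : Set} → List A → ∀ m → List (Vec A m)
vectors xs zero    = [] ∷ []
vectors xs (suc m) = cartesianProductWith _∷_ xs (vectors xs m)

∈-vectors : ∀ {A : Set} {xs : List A} → (∀ x → x ∈ₗ xs) → ∀ {m} (v : Vec A m) → v ∈ₗ vectors xs m
∈-vectors all []      = here refl
∈-vectors all (x ∷ v) = ∈-cartesianProductWith⁺ _∷_ (all x) (∈-vectors all v)

plans : ∀ n d → List (Plan n d)
plans n zero    = tt ∷ []
plans n (suc d) = vectors (cartesianProduct (vectors (inside ∷ outside ∷ []) n) (plans n d)) n

∈-plans : ∀ d (p : Plan n d) → p ∈ₗ plans n d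
∈-plans zero    tt = here refl
∈-plans (suc d) p  = ∈-vectors (λ (s , q) → ∈-cartesianProduct⁺ (∈-vectors sides s) (∈-plans d q)) p
  where
  sides : ∀ b → b ∈ₗ inside ∷ outside ∷ []
  sides true  = here refl
  sides false = there (here refl)

Catches : (G : Graph n) → ℕ → ∀ d → Plan n d → Fin n → Subset n → Set
Catches G k zero    p v C = Absurd
Catches G k (suc d) p v C =
  proj₁ (lookup p v) ⊆ C ∪ ⁅ v ⁆ × ∣ proj₁ (lookup p v) ∣ ≤ k ×
  (∀ w → E G v w → w ∉ proj₁ (lookup p v) → Catches G k d (proj₂ (lookup p v)) w (proj₁ (lookup p v)))

-- One plan has to answer all robber vertices allowed at this stage. `P` describes them; in the
-- recursion they are the neighbours outside `D`.
catchIn⇒plan : ∀ (G : Graph n) → (∀ v w → Dec (E G v w)) → ∀ d {P : Fin n → Set} {C} →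
               (∀ v → Dec (P v)) → (∀ v → P v → CatchIn G k d v C) →
               ∃[ p ] (∀ v → P v → Catches G k d p v C)
catchIn⇒plan G E? zero P? c = tt , c
catchIn⇒plan {n} {k} G E? (suc d) {P} {C} P? c = tabulateᵥ (proj₁ ∘ entry) , correct
  where
  CatchesVia : Fin n → Subset n × Plan n d → Set
  CatchesVia v (D , q) = D ⊆ C ∪ ⁅ v ⁆ × ∣ D ∣ ≤ k × (∀ w → E G v w → w ∉ D → Catches G k d q w D)

  entry : ∀ v → ∃[ e ] (P v → CatchesVia v e)
  entry v with P? v
  ... | no ¬p = (⊥ , idle d) , λ p → contradiction p ¬p
  ... | yes p with c v p
  ...   | D , D⊆ , ∣D∣≤k , next
    with catchIn⇒plan G E? d {λ w → E G v w × w ∉ D} (λ w → E? v w ×-dec ¬? (w ∈? D)) (λ w (e , w∉) → next w e w∉)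
  ...     | q , good = (D , q) , λ _ → D⊆ , ∣D∣≤k , λ w e w∉ → good w (e , w∉)

  correct : ∀ v → P v → CatchesVia v (lookup (tabulateᵥ (proj₁ ∘ entry)) v)
  correct v p = subst (CatchesVia v) (sym (lookup∘tabulate (proj₁ ∘ entry) v)) (proj₂ (entry v) p)

-- The universal strategy

-- Level `l` plays all plans of depth `suc l`; `queue` holds those not yet started. The current plan
-- always has a round left, so a request can be read off at any time.
record Schedule (n : ℕ) : Set where
  constructor schedule
  field
    level     : ℕ
    queue     : List (Plan n (suc level))
    remaining : ℕ
    current   : Plan n (suc remaining)

advance : ∀ l → List (Plan n (suc l)) → Schedule n
-- A filler round opens each level, so that `plans` need not be shown nonempty here.
advance l []       = schedule (suc l) (plans _ (suc (suc l))) 0 (idle 1)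
advance l (p ∷ ps) = schedule l ps l p

update : Schedule n → Fin n → Schedule n
update (schedule l q zero    p) v = advance l q
update (schedule l q (suc r) p) v = schedule l q r (proj₂ (lookup p v))

request : Schedule n → Fin n → Subset n
request s v = proj₁ (lookup (Schedule.current s) v)

run : List (Fin n × Subset n) → Schedule n
run = foldl (λ s (v , _) → update s v) (schedule 0 (plans _ 1) 0 (idle 1))

-- Legal cops can do without dropping: they keep a superset of the requested set.
cover : ∀ (C D : Subset n) v → ∣ C ∣ ≤ k →
        Σ[ C′ ∈ Subset n ] (Legal k v C C′ × (D ⊆ C ∪ ⁅ v ⁆ → ∣ D ∣ ≤ k → D ⊆ C′))
cover {k = k} C D v ∣C∣≤k with ∣ C ∪ ⁅ v ⁆ ∣ ≤? k
... | yes fits = C ∪ ⁅ v ⁆ , (inj₂ (inj₁ refl) , fits) , λ D⊆ _ → D⊆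
... | no ¬fits with v ∈? D
...   | no v∉D = C , (inj₁ refl , ∣C∣≤k) , λ D⊆ _ {x} x∈D →
  [ id , (λ { refl → contradiction x∈D v∉D }) ]′ (∈-∪⁅⁆⁻ C (D⊆ x∈D))
...   | yes v∈D with any? (λ x → (x ∈? C) ×-dec ¬? (x ∈? D))
...     | yes (x , x∈C , x∉D) =
  (C - x) ∪ ⁅ v ⁆ ,
  (inj₂ (inj₂ (x , x∈C , refl)) ,
   ≤-trans (∣p∪⁅x⁆∣≤1+∣p∣ (C - x) v) (≤-trans (x∈p⇒∣p-x∣<∣p∣ x∈C) ∣C∣≤k)) ,
  λ D⊆ _ y∈D →
    [ (λ y∈C → ⊆∪⁅⁆ (C - x) (x∈p∧x≢y⇒x∈p-y y∈C λ { refl → x∉D y∈D })) , v∈∪⁅v⁆ (C - x) ]′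
      (∈-∪⁅⁆⁻ C (D⊆ y∈D))
-- With no cop to spare, `D` would contain all of `C ∪ ⁅ v ⁆`, which has more than `k` elements.
...     | no ¬spare = C , (inj₁ refl , ∣C∣≤k) , λ _ ∣D∣≤k →
  contradiction (≤-trans (p⊆q⇒∣p∣≤∣q∣ C∪v⊆D) ∣D∣≤k) ¬fits
  where
  C∪v⊆D : C ∪ ⁅ v ⁆ ⊆ D
  C∪v⊆D {x} x∈ with ∈-∪⁅⁆⁻ C x∈
  ... | inj₂ refl = v∈D
  ... | inj₁ x∈C  = decidable-stable (x ∈? D) λ x∉D → ¬spare (x , x∈C , x∉D)

universal : ∀ n k → CopStrategy n k
universal n k h v C ∣C∣≤k with cover C (request (run h) v) v ∣C∣≤k
... | C′ , legal , _ = C′ , legal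

-- Plays against the universal strategy

module _ {G : Graph n} (play : InfinitePlay G (universal n k)) where
  open InfinitePlay play

  scheduleAt : ℕ → Schedule n
  scheduleAt i = run (tabulate {n = i} (λ j → pos (toℕ j) , cops (toℕ j)))

  scheduleAt-suc : ∀ i → scheduleAt (suc i) ≡ update (scheduleAt i) (pos i)
  scheduleAt-suc i = trans (cong run (tabulate-toℕ-∷ʳ (λ j → pos j , cops j) i)) (foldl-∷ʳ _ _ _ (tabulate {n = i} _))

  request-granted : ∀ i {s} → scheduleAt i ≡ s → request s (pos i) ⊆ cops i ∪ ⁅ pos i ⁆ →
                    ∣ request s (pos i) ∣ ≤ k → request s (pos i) ⊆ cops (suc i)
  request-granted i refl D⊆ ∣D∣≤k {x} x∈D =
    subst (x ∈_) (sym (copsMove i))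
      (proj₂ (proj₂ (cover (cops i) (request (scheduleAt i) (pos i)) (pos i) (bound i))) D⊆ ∣D∣≤k x∈D)

  -- The plan reckons with a set `C` inside the actual cop set. Extra cops only restrict the robber
  -- further: a vertex free of actual cops is also outside the requested set.
  catches-next : ∀ r i {l q p C} → scheduleAt i ≡ schedule l q r p →
                 C ⊆ cops i → Catches G k (suc r) p (pos i) C →
                 ∃[ D ] (D ⊆ cops (suc i) × Catches G k r (proj₂ (lookup p (pos i))) (pos (suc i)) D)
  catches-next r i {p = p} {C} eq C⊆ (D⊆ , ∣D∣≤k , next) =
    proj₁ (lookup p (pos i)) , granted , next (pos (suc i)) (robberEdge i) (robberFree i ∘ granted)
    where
    granted : proj₁ (lookup p (pos i)) ⊆ cops (suc i)
    granted = request-granted i eq ([ ⊆∪⁅⁆ (cops i) ∘ C⊆ , v∈∪⁅v⁆ (cops i) ]′ ∘ ∈-∪⁅⁆⁻ C ∘ D⊆) ∣D∣≤k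

  -- Each round passes to the rest of the plan, until `Catches` at depth 0 is absurd.
  ¬catches : ∀ r i {l q p C} → scheduleAt i ≡ schedule l q r p →
             C ⊆ cops i → ¬ Catches G k (suc r) p (pos i) C
  ¬catches zero    i {p = p} eq C⊆ c with catches-next zero i {p = p} eq C⊆ c
  ... | _ , _ , ()
  ¬catches (suc r) i {p = p} eq C⊆ c with catches-next (suc r) i {p = p} eq C⊆ c
  ... | D , D⊆ , c′ =
    ¬catches r (suc i) (trans (scheduleAt-suc i) (cong (λ s → update s (pos i)) eq)) D⊆ c′

  plan-ends : ∀ r i {l q p} → scheduleAt i ≡ schedule l q r p → ∃[ i′ ] scheduleAt i′ ≡ advance l q
  plan-ends zero    i eq = suc i , trans (scheduleAt-suc i) (cong (λ s → update s (pos i)) eq)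
  plan-ends (suc r) i eq = plan-ends r (suc i) (trans (scheduleAt-suc i) (cong (λ s → update s (pos i)) eq))

  -- The queued plan eventually becomes current, with the robber on an unpredictable vertex, hence
  -- the quantifier over `v`. It may start from `⊥`, which lies inside any cop set.
  ¬catches-queued : ∀ {l q p} → p ∈ₗ q → ∀ {r} i {p′} → scheduleAt i ≡ schedule l q r p′ →
                    ¬ (∀ v → Catches G k (suc l) p v ⊥)
  ¬catches-queued {l} (here refl) {r} i eq c with plan-ends r i eq
  ... | i′ , eq′ = ¬catches l i′ eq′ ⊥⊆ (c (pos i′))
  ¬catches-queued (there p∈) {r} i eq c with plan-ends r i eq
  ... | i′ , eq′ = ¬catches-queued p∈ i′ eq′ c

  queue-ends : ∀ {l} q {r} i {p} → scheduleAt i ≡ schedule l q r p → ∃[ i′ ] scheduleAt i′ ≡ advance l []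
  queue-ends []      {r} i eq = plan-ends r i eq
  queue-ends (p ∷ q) {r} i eq with plan-ends r i eq
  ... | i′ , eq′ = queue-ends q i′ eq′

  level-reached : ∀ l → ∃[ i ] scheduleAt i ≡ schedule l (plans n (suc l)) 0 (idle 1)
  level-reached zero    = 0 , refl
  level-reached (suc l) with level-reached l
  ... | i , eq = queue-ends (plans n (suc l)) i eq

  no-catching-plan : ∀ d p → ¬ (∀ v → Catches G k d p v ⊥)
  no-catching-plan zero    p c = c (pos 0)
  no-catching-plan (suc d) p c with level-reached d
  ... | i , eq = ¬catches-queued (∈-plans (suc d) p) i eq c

universal-wins : ∀ (G : Graph n) → (∀ v → Catchable G k v ⊥) → ¬ InfinitePlay G (universal n k)
universal-wins G c play =
  -- The goal is absurdity, so edges may be taken as decidable; the strategy was fixed beforehand.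
  ¬¬-decidable-E G λ E? →
  let everywhere = λ _ → yes tt
      d , c-d    = catchable-uniform G everywhere (λ v _ → c v)
      p , good   = catchIn⇒plan G E? d everywhere c-d
  in no-catching-plan play d p (λ v → good v tt)

theorem1 : ∀ {m n} (G : Graph m) (H : Graph n) → Minor G H →
             (k : ℕ) → EntAtMost H k → EntAtMost G k
theorem1 {m} G H M k (j , j≤k , _ , win) =
  -- `G` may have fewer than `j` vertices, hence the minimum. The strategy is given outright, and
  -- only its success is derived under the double negation.
  j ⊓ m , ≤-trans (m⊓n≤m j m) j≤k , m⊓n≤n j m , universal m (j ⊓ m) , λ play →
  copsWin⇒catchable H win λ c →
  universal-wins G (λ v → let d , c′ = catchable-minor M c v in d , catchIn-⊓ G d c′) play
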